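{- For every (finite, simple) graph $G$ with treewidth $tw(G)\leq 2$ we have $b(G)\leq 2$, i.e., $G$ is a $2$-bend graph.
   Context: An EPG representation of a simple graph $G$ is an assignment of a finite path $P(u)$ in the rectangular plane grid (a sequence of consecutive grid edges, not self-intersecting in grid edges) to every vertex $u$ of $G$, such that for distinct $u,v$, the paths $P(u)$ and $P(v)$ share at least one grid edge if and only if $\{u,v\}\in E(G)$ (intersections only at grid vertices do not count). A bend of a path is a horizontal grid edge followed by a vertical one, or a vertical one followed by a horizontal one. $G$ is a $k$-bend graph if it has an EPG representation in which every path has at most $k$ bends. The bend-number $b(G)$ is the minimum $k$ such that $G$ is a $k$-bend graph. -}

module Defs where

open import Data.Nat using (ℕ; zero; suc; _+_; _≤_)
open import Data.Integer as ℤ using (ℤ)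
open import Data.Bool using (Bool; true; false; _xor_; if_then_else_)
open import Data.Fin using (Fin; toℕ)
import Data.Fin as F
open import Data.List using (List; []; _∷_; length)
open import Data.List.Membership.Propositional using (_∈_)
open import Data.List.Relation.Unary.Linked using (Linked)
open import Data.List.Relation.Unary.AllPairs using (AllPairs)
open import Data.List.Relation.Unary.Any using (Any)
open import Data.Product using (Σ; ∃; ∃-syntax; _×_; _,_; proj₁; proj₂)
open import Data.Sum using (_⊎_)
open import Relation.Nullary using (¬_)
open import Relation.Nullary.Decidable using (⌊_⌋)
open import Relation.Binary.PropositionalEquality using (_≡_; _≢_)

record Graph : Set where
  field
    n     : ℕ
    adj   : Fin n → Fin n → Bool
    sym   : ∀ u v → adj u v ≡ adj v u
    irrefl : ∀ u → adj u u ≡ false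

open Graph public

Edge : (G : Graph) → Fin (n G) → Fin (n G) → Set
Edge G u v = adj G u v ≡ true

-- Tree decompositions and treewidth
-- A tree with node set Fin (suc m) is given by parent pointers:
-- node (suc i) has parent (parent i), whose index is at most i
-- (i.e. strictly smaller than suc i).  Its edges are {suc i , parent i}.

record Tree : Set where
  field
    m        : ℕ
    parent   : Fin m → Fin (suc m)
    parent<  : ∀ i → toℕ (parent i) ≤ toℕ i

open Tree public

Node : Tree → Set
Node T = Fin (suc (m T))

TreeAdj : (T : Tree) → Node T → Node T → Set
TreeAdj T s t =
  (∃[ i ] (s ≡ F.suc i × t ≡ parent T i)) ⊎ (∃[ i ] (t ≡ F.suc i × s ≡ parent T i))

data WalkIn (T : Tree) (P : Node T → Set) : Node T → Node T → Set where
  here : ∀ {s} → WalkIn T P s s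
  step : ∀ {s x t} → TreeAdj T s x → P x → WalkIn T P x t → WalkIn T P s t

record TreeDecomposition (G : Graph) (w : ℕ) : Set where
  field
    tree      : Tree
    bag       : Node tree → List (Fin (n G))
    bagSize   : ∀ t → length (bag t) ≤ suc w
    vcover    : ∀ v → ∃[ t ] (v ∈ bag t)
    ecover    : ∀ u v → Edge G u v → ∃[ t ] (u ∈ bag t × v ∈ bag t)
    connected : ∀ v s t → v ∈ bag s → v ∈ bag t →
                WalkIn tree (λ x → v ∈ bag x) s t

TreewidthAtMost : ℕ → Graph → Set
TreewidthAtMost w G = TreeDecomposition G w

Point : Set
Point = ℤ × ℤ

HorizontalStep : Point → Point → Set
HorizontalStep (x , y) (x' , y') = y ≡ y' × ((x' ≡ x ℤ.+ ℤ.1ℤ) ⊎ (x ≡ x' ℤ.+ ℤ.1ℤ))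

VerticalStep : Point → Point → Set
VerticalStep (x , y) (x' , y') = x ≡ x' × ((y' ≡ y ℤ.+ ℤ.1ℤ) ⊎ (y ≡ y' ℤ.+ ℤ.1ℤ))

GridStep : Point → Point → Set
GridStep p q = HorizontalStep p q ⊎ VerticalStep p q

edgesOf : List Point → List (Point × Point)
edgesOf (p ∷ q ∷ ps) = (p , q) ∷ edgesOf (q ∷ ps)
edgesOf _ = []

SameEdge : Point × Point → Point × Point → Set
SameEdge (a , b) (c , d) = (a ≡ c × b ≡ d) ⊎ (a ≡ d × b ≡ c)

-- is the step p → q horizontal (for grid steps: equal y-coordinates)
isHorizontal : Point → Point → Bool
isHorizontal (_ , y) (_ , y') = ⌊ y ℤ.≟ y' ⌋

bendAt : Point → Point → Point → ℕ
bendAt p q r = if isHorizontal p q xor isHorizontal q r then 1 else 0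

bends : List Point → ℕ
bends (p ∷ q ∷ r ∷ ps) = bendAt p q r + bends (q ∷ r ∷ ps)
bends _ = 0

record GridPath : Set where
  field
    points      : List Point
    nonempty    : 1 ≤ length (edgesOf points)
    consecutive : Linked GridStep points
    edgeSimple  : AllPairs (λ e f → ¬ SameEdge e f) (edgesOf points)

open GridPath public

ShareEdge : GridPath → GridPath → Set
ShareEdge P Q =
  Any (λ e → Any (λ f → SameEdge e f) (edgesOf (points Q))) (edgesOf (points P))

record KBendRepresentation (k : ℕ) (G : Graph) : Set where
  field
    path     : Fin (n G) → GridPath
    fewBends : ∀ u → bends (points (path u)) ≤ k
    faithful : ∀ u v → u ≢ v →
               (ShareEdge (path u) (path v) → Edge G u v) ×
               (Edge G u v → ShareEdge (path u) (path v))

IsKBend : ℕ → Graph → Set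
IsKBend k G = KBendRepresentation k G

{-# OPTIONS --safe #-}
-- Vertices enter along the tree decomposition, each next to at most two
-- earlier vertices a, b, which share a bag.  Any two vertices of a bag are kept
-- in one of two positions: "parallel", where both own private grid edges of the
-- same direction that are translates of each other across it, or "joint",
-- where some grid edge lies on exactly their two paths while one of them owns a private edge along
-- that direction and the other one a private edge across it.
--
-- A new path c can start on any grid edge, then cross over and end so as to be
-- parallel to a prescribed edge in each of the two directions.  Started on a
-- joint edge, on a private edge of a or b, or in empty space, it has the right
-- neighbours and is parallel to both a and b.  Only when c is adjacent to both
-- members of a parallel pair must it join the two private edges directly; it
-- then uses both of its bends, but becomes joint with a and with b, since its
-- middle leg is private.  Scaling the picture by 4 makes room for c.

module Submission where

open import Defs
open import Data.Bool using (Bool; true; false; not; _xor_; if_then_else_)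
open import Data.Bool.Properties using (not-¬; not-involutive)
open import Data.Fin using (Fin; toℕ; fromℕ<; _≟_)
import Data.Fin as F
open import Data.Fin.Properties using (toℕ-injective; toℕ-fromℕ<; toℕ<n)
open import Data.Integer as ℤ using (+_)
open import Data.List using (List; []; _∷_; length)
open import Data.List.Membership.Propositional using (_∈_; _∉_; find; lose)
open import Data.List.Relation.Unary.All as All using (All)
open import Data.List.Relation.Unary.All.Properties using (¬Any⇒All¬)
open import Data.List.Relation.Unary.AllPairs using (AllPairs; []; _∷_)
open import Data.List.Relation.Unary.Any using (here; there)
open import Data.List.Relation.Unary.Linked using (Linked; [-]; _∷_)
open import Data.List.Relation.Unary.Unique.Propositional using (Unique)
open import Data.Maybe as Maybe using (Maybe; just; nothing; maybe′)
open import Data.Maybe.Properties using (just-injective)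
open import Data.Nat using
  ( ℕ; zero; suc; _+_; _*_; _/_; _%_; _⊔_; _≤_; _<_; z≤n; s≤s; s≤s⁻¹; _≤?_; _<?_
  ; _≤′_; _≤‴_; ≤′-step; ≤‴-step; ≤′-refl; ≤‴-refl )
open import Data.Nat.Divisibility using (divides-refl)
open import Data.Nat.DivMod
open import Data.Nat.Properties hiding (_≟_; _≤?_; _<?_)
open import Data.Product using (∃; ∃-syntax; _×_; _,_; proj₁; proj₂)
open import Data.Sum using (_⊎_; inj₁; inj₂; reduce; swap)
open import Function using (_∘_; case_of_)
open import Relation.Binary.PropositionalEquality
  using (_≡_; _≢_; refl; trans; cong; cong₂; subst) renaming (sym to ≡-sym)
open import Relation.Nullary using (¬_; Dec; yes; no; contradiction)

-- Three-leg grid paths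

-- The unit grid edge (o , l , b) runs from b to b + 1 along line l, which
-- is horizontal for o = true and vertical for o = false.
Slot : Set
Slot = Bool × ℕ × ℕ

pt : Bool → ℕ → ℕ → Point
pt true  l b = + b , + l
pt false l b = + l , + b

ends : Slot → Point × Point
ends (o , l , b) = pt o l b , pt o l (suc b)

data Move : Slot → Point → Point → Set where
  fwd : ∀ {o l b} → Move (o , l , b) (pt o l b) (pt o l (suc b))
  bwd : ∀ {o l b} → Move (o , l , b) (pt o l (suc b)) (pt o l b)

SameEdge-sym : ∀ {e f} → SameEdge e f → SameEdge f e
SameEdge-sym (inj₁ (refl , refl)) = inj₁ (refl , refl)
SameEdge-sym (inj₂ (refl , refl)) = inj₂ (refl , refl)

SameEdge-trans : ∀ {e f g} → SameEdge e f → SameEdge f g → SameEdge e g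
SameEdge-trans (inj₁ (refl , refl)) s = s
SameEdge-trans (inj₂ (refl , refl)) (inj₁ (refl , refl)) = inj₂ (refl , refl)
SameEdge-trans (inj₂ (refl , refl)) (inj₂ (refl , refl)) = inj₁ (refl , refl)

-- Each unoriented grid edge has only one slot as its name, because a number never equals its own
-- successor. Sharing an edge can thus be decided by equality of slots.
ends-injective : ∀ e f → SameEdge (ends e) (ends f) → e ≡ f
ends-injective (true  , _) (true  , _) (inj₁ (refl , refl)) = refl
ends-injective (true  , _) (true  , _) (inj₂ (refl , ()))
ends-injective (true  , _) (false , _) (inj₁ (refl , ()))
ends-injective (true  , _) (false , _) (inj₂ (refl , ()))
ends-injective (false , _) (true  , _) (inj₁ (refl , ()))
ends-injective (false , _) (true  , _) (inj₂ (refl , ()))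
ends-injective (false , _) (false , _) (inj₁ (refl , refl)) = refl
ends-injective (false , _) (false , _) (inj₂ (refl , ()))

move-ends : ∀ {e p q} → Move e p q → SameEdge (p , q) (ends e)
move-ends fwd = inj₁ (refl , refl)
move-ends bwd = inj₂ (refl , refl)

move-gridStep : ∀ {e p q} → Move e p q → GridStep p q
move-gridStep (fwd {true}  {b = b}) = inj₁ (refl , inj₁ (cong +_ (+-comm 1 b)))
move-gridStep (fwd {false} {b = b}) = inj₂ (refl , inj₁ (cong +_ (+-comm 1 b)))
move-gridStep (bwd {true}  {b = b}) = inj₁ (refl , inj₂ (cong +_ (+-comm 1 b)))
move-gridStep (bwd {false} {b = b}) = inj₂ (refl , inj₂ (cong +_ (+-comm 1 b)))

move-isHorizontal : ∀ {o a p q} → Move (o , a) p q → isHorizontal p q ≡ o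
move-isHorizontal (fwd {true} {l}) with + l ℤ.≟ + l
... | yes _ = refl
... | no ≢  = contradiction refl ≢
move-isHorizontal (fwd {false} {b = b}) with + b ℤ.≟ + suc b
... | yes ()
... | no _ = refl
move-isHorizontal (bwd {true} {l}) with + l ℤ.≟ + l
... | yes _ = refl
... | no ≢  = contradiction refl ≢
move-isHorizontal (bwd {false} {b = b}) with + suc b ℤ.≟ + b
... | yes ()
... | no _ = refl

-- Routes and the number of their turns

data Route : Point → Set where
  end : ∀ {p} → Route p
  go   : ∀ {e p q} → Move e p q → Route q → Route p

rest : ∀ {p} → Route p → List Point
rest end             = []
rest (go {q = q} _ w) = q ∷ rest w

slots : ∀ {p} → Route p → List Slot
slots end             = []
slots (go {e = e} _ w) = e ∷ slots w

linked : ∀ {p} (w : Route p) → Linked GridStep (p ∷ rest w)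
linked end     = [-]
linked (go s w) = move-gridStep s ∷ linked w

edge⇒slot : ∀ {p f} (w : Route p) → f ∈ edgesOf (p ∷ rest w) →
            ∃[ e ] (e ∈ slots w × SameEdge f (ends e))
edge⇒slot (go s w) (here refl) = _ , here refl , move-ends s
edge⇒slot (go s w) (there f∈)  =
  let e , e∈ , same = edge⇒slot w f∈ in e , there e∈ , same

slot⇒edge : ∀ {p e} (w : Route p) → e ∈ slots w →
            ∃[ f ] (f ∈ edgesOf (p ∷ rest w) × SameEdge f (ends e))
slot⇒edge (go s w) (here refl) = _ , here refl , move-ends s
slot⇒edge (go s w) (there e∈)  =
  let f , f∈ , same = slot⇒edge w e∈ in f , there f∈ , same

edges-nonempty : ∀ {e p} (w : Route p) → e ∈ slots w → 1 ≤ length (edgesOf (p ∷ rest w))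
edges-nonempty (go _ _) _ = s≤s z≤n

unique⇒edgeSimple : ∀ {p} (w : Route p) → Unique (slots w) →
                    AllPairs (λ e f → ¬ SameEdge e f) (edgesOf (p ∷ rest w))
unique⇒edgeSimple end     _          = []
unique⇒edgeSimple (go s w) (e∉ ∷ uniq) =
  All.tabulate (λ f∈ same →
    let e , e∈ , same′ = edge⇒slot w f∈ in
    All.lookup e∉ e∈ (ends-injective _ _
      (SameEdge-trans (SameEdge-sym (move-ends s)) (SameEdge-trans same same′))))
  ∷ unique⇒edgeSimple w uniq

∈-cong : ∀ {e : Slot} {es fs} → es ≡ fs → e ∈ es → e ∈ fs
∈-cong refl e∈ = e∈

turn : Bool → Bool → ℕ
turn o o′ = if o xor o′ then 1 else 0

turn-self : ∀ o → turn o o ≡ 0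
turn-self true  = refl
turn-self false = refl

turn≤1 : ∀ o o′ → turn o o′ ≤ 1
turn≤1 true  true  = z≤n
turn≤1 true  false = ≤-refl
turn≤1 false true  = ≤-refl
turn≤1 false false = z≤n

turn-triangle : ∀ o o′ o″ → turn o o″ ≤ turn o o′ + turn o′ o″
turn-triangle true  true  _     = ≤-refl
turn-triangle false false _     = ≤-refl
turn-triangle true  false true  = z≤n
turn-triangle true  false false = ≤-refl
turn-triangle false true  true  = ≤-refl
turn-triangle false true  false = z≤n

-- Turns are counted relative to the direction of an imagined step before the route, so the count
-- makes sense for an empty route and adds up leg by leg.
turnsAfter : ∀ {p} → Bool → Route p → ℕ
turnsAfter o end                   = 0
turnsAfter o (go {e = o′ , _} _ w) = turn o o′ + turnsAfter o′ w

-- A leg may be empty, and its direction is then only nominal. By the triangle inequality a nominal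
-- change of direction never lowers the count, which spares a case distinction on empty legs.
turnsAfter-change : ∀ {p} o o′ (w : Route p) → turnsAfter o w ≤ turn o o′ + turnsAfter o′ w
turnsAfter-change o o′ end                   = z≤n
turnsAfter-change o o′ (go {e = o″ , _} _ w) = begin
  turn o o″ + turnsAfter o″ w               ≤⟨ +-monoˡ-≤ _ (turn-triangle o o′ o″) ⟩
  turn o o′ + turn o′ o″ + turnsAfter o″ w ≡⟨ +-assoc (turn o o′) _ _ ⟩
  turn o o′ + (turn o′ o″ + turnsAfter o″ w) ∎
  where open ≤-Reasoning

bends-go : ∀ {o a p q} (s : Move (o , a) p q) (w : Route q) →
           bends (p ∷ q ∷ rest w) ≡ turnsAfter o w
bends-go s end = refl
bends-go s (go t w)
  rewrite move-isHorizontal s | move-isHorizontal t | bends-go t w = refl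

bends≤turns : ∀ {p} o (w : Route p) → bends (p ∷ rest w) ≤ turnsAfter o w
bends≤turns o end                       = z≤n
bends≤turns o (go {e = o′ , _} s w) = ≤-trans (≤-reflexive (bends-go s w)) (m≤n+m _ (turn o o′))

-- Straight legs

ascend : ∀ o l {a b} → a ≤‴ b → Route (pt o l b) → Route (pt o l a)
ascend o l ≤‴-refl       w = w
ascend o l (≤‴-step a<b) w = go fwd (ascend o l a<b w)

-- Each order is chosen so that its induction moves the end where the walk starts: `≤′` the upper
-- end here, `≤‴` the lower end in `ascend`.
descend : ∀ o l {a b} → a ≤′ b → Route (pt o l a) → Route (pt o l b)
descend o l ≤′-refl       w = w
descend o l (≤′-step a≤b) w = go bwd (descend o l a≤b w)

leg : ∀ o l a b → Route (pt o l b) → Route (pt o l a)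
leg o l a b w with ≤-total a b
... | inj₁ a≤b = ascend  o l (≤⇒≤‴ a≤b) w
... | inj₂ b≤a = descend o l (≤⇒≤′ b≤a) w

Between : ℕ → ℕ → ℕ → Set
Between x a b = (a ≤ x × x < b) ⊎ (b ≤ x × x < a)

between-nonempty : ∀ {a b} → a ≢ b → ∃[ x ] Between x a b
between-nonempty {a} {b} a≢b with ≤-total a b
... | inj₁ a≤b = a , inj₁ (≤-refl , ≤∧≢⇒< a≤b a≢b)
... | inj₂ b≤a = b , inj₂ (≤-refl , ≤∧≢⇒< b≤a (a≢b ∘ ≡-sym))

module _ {o : Bool} {l : ℕ} where

  ascend-slots⁻ : ∀ {a b e} (a≤b : a ≤‴ b) (w : Route (pt o l b)) → e ∈ slots (ascend o l a≤b w) →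
                  (∃[ x ] (e ≡ (o , l , x) × a ≤ x × x < b)) ⊎ e ∈ slots w
  ascend-slots⁻ ≤‴-refl       w e∈          = inj₂ e∈
  ascend-slots⁻ (≤‴-step a<b) w (here refl) = inj₁ (_ , refl , ≤-refl , ≤‴⇒≤ a<b)
  ascend-slots⁻ (≤‴-step a<b) w (there e∈) with ascend-slots⁻ a<b w e∈
  ... | inj₁ (x , e≡ , a<x , x<b) = inj₁ (x , e≡ , <⇒≤ a<x , x<b)
  ... | inj₂ e∈w                  = inj₂ e∈w

  ascend-slotsˡ : ∀ {a b x} (a≤b : a ≤‴ b) (w : Route (pt o l b)) → a ≤ x → x < b →
                  (o , l , x) ∈ slots (ascend o l a≤b w)
  ascend-slotsˡ ≤‴-refl       w a≤x x<a = contradiction a≤x (<⇒≱ x<a)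
  ascend-slotsˡ (≤‴-step a<b) w a≤x x<b with m≤n⇒m<n∨m≡n a≤x
  ... | inj₁ a<x  = there (ascend-slotsˡ a<b w a<x x<b)
  ... | inj₂ refl = here refl

  ascend-slotsʳ : ∀ {a b e} (a≤b : a ≤‴ b) (w : Route (pt o l b)) →
                  e ∈ slots w → e ∈ slots (ascend o l a≤b w)
  ascend-slotsʳ ≤‴-refl       w e∈ = e∈
  ascend-slotsʳ (≤‴-step a<b) w e∈ = there (ascend-slotsʳ a<b w e∈)

  ascend-unique : ∀ {a b} (a≤b : a ≤‴ b) (w : Route (pt o l b)) →
                  (∀ x → Between x a b → (o , l , x) ∉ slots w) →
                  Unique (slots w) → Unique (slots (ascend o l a≤b w))
  ascend-unique ≤‴-refl       w new uniq = uniq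
  ascend-unique {a} (≤‴-step a<b) w new uniq =
    ¬Any⇒All¬ _ (λ a∈ → case ascend-slots⁻ a<b w a∈ of λ where
      (inj₁ (x , refl , a<a , _)) → n≮n a a<a
      (inj₂ a∈w) → new a (inj₁ (≤-refl , ≤‴⇒≤ a<b)) a∈w)
    ∷ ascend-unique a<b w
        (λ { x (inj₁ (a<x , x<b)) → new x (inj₁ (<⇒≤ a<x , x<b))
           ; x (inj₂ (b≤x , x≤a)) → contradiction (≤-trans (≤‴⇒≤ a<b) b≤x) (<⇒≱ x≤a) }) uniq

  ascend-turns : ∀ {a b} (a≤b : a ≤‴ b) (w : Route (pt o l b)) →
                 turnsAfter o (ascend o l a≤b w) ≡ turnsAfter o w
  ascend-turns ≤‴-refl       w = refl
  ascend-turns (≤‴-step a<b) w rewrite turn-self o = ascend-turns a<b w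

  descend-slots⁻ : ∀ {a b e} (a≤b : a ≤′ b) (w : Route (pt o l a)) → e ∈ slots (descend o l a≤b w) →
                   (∃[ x ] (e ≡ (o , l , x) × a ≤ x × x < b)) ⊎ e ∈ slots w
  descend-slots⁻ ≤′-refl       w e∈          = inj₂ e∈
  descend-slots⁻ (≤′-step a≤b) w (here refl) = inj₁ (_ , refl , ≤′⇒≤ a≤b , ≤-refl)
  descend-slots⁻ (≤′-step a≤b) w (there e∈) with descend-slots⁻ a≤b w e∈
  ... | inj₁ (x , e≡ , a≤x , x<b) = inj₁ (x , e≡ , a≤x , m≤n⇒m≤1+n x<b)
  ... | inj₂ e∈w                  = inj₂ e∈w

  descend-slotsˡ : ∀ {a b x} (a≤b : a ≤′ b) (w : Route (pt o l a)) → a ≤ x → x < b →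
                   (o , l , x) ∈ slots (descend o l a≤b w)
  descend-slotsˡ ≤′-refl       w a≤x x<a = contradiction a≤x (<⇒≱ x<a)
  descend-slotsˡ (≤′-step a≤b) w a≤x x<b with m≤n⇒m<n∨m≡n (s≤s⁻¹ x<b)
  ... | inj₁ x<b′ = there (descend-slotsˡ a≤b w a≤x x<b′)
  ... | inj₂ refl = here refl

  descend-slotsʳ : ∀ {a b e} (a≤b : a ≤′ b) (w : Route (pt o l a)) →
                   e ∈ slots w → e ∈ slots (descend o l a≤b w)
  descend-slotsʳ ≤′-refl       w e∈ = e∈
  descend-slotsʳ (≤′-step a≤b) w e∈ = there (descend-slotsʳ a≤b w e∈)

  descend-unique : ∀ {a b} (a≤b : a ≤′ b) (w : Route (pt o l a)) →
                   (∀ x → Between x b a → (o , l , x) ∉ slots w) →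
                   Unique (slots w) → Unique (slots (descend o l a≤b w))
  descend-unique ≤′-refl       w new uniq = uniq
  descend-unique {a} {suc b} (≤′-step a≤b) w new uniq =
    ¬Any⇒All¬ _ (λ b∈ → case descend-slots⁻ a≤b w b∈ of λ where
      (inj₁ (x , refl , _ , b<b)) → n≮n b b<b
      (inj₂ b∈w) → new b (inj₂ (≤′⇒≤ a≤b , ≤-refl)) b∈w)
    ∷ descend-unique a≤b w
        (λ { x (inj₁ (b≤x , x<a)) → contradiction (≤-trans (≤′⇒≤ a≤b) b≤x) (<⇒≱ x<a)
           ; x (inj₂ (a≤x , x<b)) → new x (inj₂ (a≤x , m≤n⇒m≤1+n x<b)) }) uniq

  descend-turns : ∀ {a b} (a≤b : a ≤′ b) (w : Route (pt o l a)) →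
                  turnsAfter o (descend o l a≤b w) ≡ turnsAfter o w
  descend-turns ≤′-refl       w = refl
  descend-turns (≤′-step a≤b) w rewrite turn-self o = descend-turns a≤b w

  leg-slots⁻ : ∀ a b {e} (w : Route (pt o l b)) → e ∈ slots (leg o l a b w) →
               (∃[ x ] (e ≡ (o , l , x) × Between x a b)) ⊎ e ∈ slots w
  leg-slots⁻ a b w e∈ with ≤-total a b
  leg-slots⁻ a b w e∈ | inj₁ a≤b with ascend-slots⁻ (≤⇒≤‴ a≤b) w e∈
  ... | inj₁ (x , e≡ , btw) = inj₁ (x , e≡ , inj₁ btw)
  ... | inj₂ e∈w            = inj₂ e∈w
  leg-slots⁻ a b w e∈ | inj₂ b≤a with descend-slots⁻ (≤⇒≤′ b≤a) w e∈
  ... | inj₁ (x , e≡ , btw) = inj₁ (x , e≡ , inj₂ btw)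
  ... | inj₂ e∈w            = inj₂ e∈w

  leg-slotsˡ : ∀ a b {x} (w : Route (pt o l b)) → Between x a b → (o , l , x) ∈ slots (leg o l a b w)
  leg-slotsˡ a b w btw with ≤-total a b | btw
  ... | inj₁ a≤b | inj₁ (a≤x , x<b) = ascend-slotsˡ _ w a≤x x<b
  ... | inj₁ a≤b | inj₂ (b≤x , x<a) = contradiction (≤-trans a≤b b≤x) (<⇒≱ x<a)
  ... | inj₂ b≤a | inj₁ (a≤x , x<b) = contradiction (≤-trans b≤a a≤x) (<⇒≱ x<b)
  ... | inj₂ b≤a | inj₂ (b≤x , x<a) = descend-slotsˡ _ w b≤x x<a

  leg-slotsʳ : ∀ a b {e} (w : Route (pt o l b)) → e ∈ slots w → e ∈ slots (leg o l a b w)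
  leg-slotsʳ a b w e∈ with ≤-total a b
  ... | inj₁ a≤b = ascend-slotsʳ _ w e∈
  ... | inj₂ b≤a = descend-slotsʳ _ w e∈

  leg-unique : ∀ a b (w : Route (pt o l b)) → (∀ x → Between x a b → (o , l , x) ∉ slots w) →
               Unique (slots w) → Unique (slots (leg o l a b w))
  leg-unique a b w new uniq with ≤-total a b
  ... | inj₁ a≤b = ascend-unique _ w new uniq
  ... | inj₂ b≤a = descend-unique _ w new uniq

  leg-turns : ∀ a b (w : Route (pt o l b)) → turnsAfter o (leg o l a b w) ≡ turnsAfter o w
  leg-turns a b w with ≤-total a b
  ... | inj₁ a≤b = ascend-turns (≤⇒≤‴ a≤b) w
  ... | inj₂ b≤a = descend-turns (≤⇒≤′ b≤a) w

-- Both types speak of the same point, but they agree by computation only once `o` is known, so the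
-- identity is split on `o`.
corner : ∀ o {l b} → Route (pt (not o) b l) → Route (pt o l b)
corner true  w = w
corner false w = w

corner-slots : ∀ o {l b} (w : Route (pt (not o) b l)) → slots (corner o w) ≡ slots w
corner-slots true  w = refl
corner-slots false w = refl

corner-turns : ∀ o {l b} o′ (w : Route (pt (not o) b l)) →
               turnsAfter o′ (corner o w) ≡ turnsAfter o′ w
corner-turns true  _ w = refl
corner-turns false _ w = refl

corner′ : ∀ o {l b} → Route (pt o b l) → Route (pt (not o) l b)
corner′ true  w = w
corner′ false w = w

corner′-slots : ∀ o {l b} (w : Route (pt o b l)) → slots (corner′ o w) ≡ slots w
corner′-slots true  w = refl
corner′-slots false w = refl

corner′-turns : ∀ o {l b} o′ (w : Route (pt o b l)) →
                turnsAfter o′ (corner′ o w) ≡ turnsAfter o′ w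
corner′-turns true  _ w = refl
corner′-turns false _ w = refl

-- A path with three legs: along the o-line l₁ from p₀ to p₁, across to
-- the o-line l₂, and along it from p₁ to p₂.
record Shape : Set where
  constructor shape
  field
    o  : Bool
    l₁ p₀ p₁ l₂ p₂ : ℕ
    l₁≢l₂ : l₁ ≢ l₂

On : Shape → Slot → Set
On (shape o l₁ p₀ p₁ l₂ p₂ _) (o′ , l , b) =
  (o′ ≡ o × l ≡ l₁ × Between b p₀ p₁) ⊎
  (o′ ≡ not o × l ≡ p₁ × Between b l₁ l₂) ⊎
  (o′ ≡ o × l ≡ l₂ × Between b p₁ p₂)

module _ (s : Shape) where
  open Shape s

  third : Route (pt o l₂ p₁)
  third = leg o l₂ p₁ p₂ end

  second : Route (pt (not o) p₁ l₁)
  second = leg (not o) p₁ l₁ l₂ (corner′ o third)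

  route : Route (pt o l₁ p₀)
  route = leg o l₁ p₀ p₁ (corner o second)

  third⁻ : ∀ {e} → e ∈ slots third → ∃[ x ] (e ≡ (o , l₂ , x) × Between x p₁ p₂)
  third⁻ e∈ with leg-slots⁻ p₁ p₂ end e∈
  ... | inj₁ found = found

  second⁻ : ∀ {e} → e ∈ slots second →
            (∃[ x ] (e ≡ (not o , p₁ , x) × Between x l₁ l₂)) ⊎
            (∃[ x ] (e ≡ (o , l₂ , x) × Between x p₁ p₂))
  second⁻ e∈ with leg-slots⁻ l₁ l₂ (corner′ o third) e∈
  ... | inj₁ found = inj₁ found
  ... | inj₂ e∈′   = inj₂ (third⁻ (∈-cong (corner′-slots o third) e∈′))

  slots⇒On : ∀ {e} → e ∈ slots route → On s e
  slots⇒On e∈ with leg-slots⁻ p₀ p₁ (corner o second) e∈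
  ... | inj₁ (_ , refl , btw) = inj₁ (refl , refl , btw)
  ... | inj₂ e∈′ with second⁻ (∈-cong (corner-slots o second) e∈′)
  ...   | inj₁ (_ , refl , btw) = inj₂ (inj₁ (refl , refl , btw))
  ...   | inj₂ (_ , refl , btw) = inj₂ (inj₂ (refl , refl , btw))

  in-second : ∀ {e} → e ∈ slots second → e ∈ slots route
  in-second e∈ = leg-slotsʳ p₀ p₁ _ (∈-cong (≡-sym (corner-slots o second)) e∈)

  On⇒slots : ∀ {e} → On s e → e ∈ slots route
  On⇒slots (inj₁ (refl , refl , btw))        = leg-slotsˡ p₀ p₁ _ btw
  On⇒slots (inj₂ (inj₁ (refl , refl , btw))) = in-second (leg-slotsˡ l₁ l₂ _ btw)
  On⇒slots (inj₂ (inj₂ (refl , refl , btw))) =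
    in-second (leg-slotsʳ l₁ l₂ _ (∈-cong (≡-sym (corner′-slots o third))
      (leg-slotsˡ p₁ p₂ end btw)))

  -- Consecutive legs differ in direction, and the two outer legs lie on different lines by `l₁≢l₂`,
  -- so no slot occurs in two legs.
  route-unique : Unique (slots route)
  route-unique =
    leg-unique p₀ p₁ _
      (λ x _ e∈ → case second⁻ (∈-cong (corner-slots o second) e∈) of λ where
        (inj₁ (_ , e≡ , _)) → not-¬ refl (cong proj₁ e≡)
        (inj₂ (_ , e≡ , _)) → l₁≢l₂ (cong (proj₁ ∘ proj₂) e≡))
    (subst Unique (≡-sym (corner-slots o second))
      (leg-unique l₁ l₂ _
        (λ x _ e∈ → case third⁻ (∈-cong (corner′-slots o third) e∈) of λ where
          (_ , e≡ , _) → not-¬ refl (cong proj₁ (≡-sym e≡)))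
      (subst Unique (≡-sym (corner′-slots o third))
        (leg-unique p₁ p₂ end (λ _ _ ()) []))))

  -- Straight legs add nothing, and each of the two corners costs at most one turn.
  route-turns : turnsAfter o route ≤ 2
  route-turns = begin
    turnsAfter o route
      ≡⟨ leg-turns p₀ p₁ (corner o second) ⟩
    turnsAfter o (corner o second)
      ≡⟨ corner-turns o o second ⟩
    turnsAfter o second
      ≤⟨ turnsAfter-change o (not o) second ⟩
    turn o (not o) + turnsAfter (not o) second
      ≤⟨ +-mono-≤ (turn≤1 o (not o)) (≤-reflexive (leg-turns l₁ l₂ (corner′ o third))) ⟩
    1 + turnsAfter (not o) (corner′ o third)
      ≡⟨ cong suc (corner′-turns o (not o) third) ⟩
    1 + turnsAfter (not o) third
      ≤⟨ s≤s (turnsAfter-change (not o) o third) ⟩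
    1 + (turn (not o) o + turnsAfter o third)
      ≤⟨ s≤s (+-mono-≤ (turn≤1 (not o) o) (≤-reflexive (leg-turns p₁ p₂ end))) ⟩
    2 ∎
    where open ≤-Reasoning

  route-nonempty : 1 ≤ length (edgesOf (_ ∷ rest route))
  route-nonempty =
    edges-nonempty route (On⇒slots (inj₂ (inj₁ (refl , refl , proj₂ (between-nonempty l₁≢l₂)))))

  gridPath : GridPath
  gridPath = record
    { points      = _ ∷ rest route
    ; nonempty    = route-nonempty
    ; consecutive = linked route
    ; edgeSimple  = unique⇒edgeSimple route route-unique
    }

  gridPath-bends : bends (points gridPath) ≤ 2
  gridPath-bends = ≤-trans (bends≤turns o route) route-turns

-- Shared grid edges as common slots

share⇒common : ∀ s t → ShareEdge (gridPath s) (gridPath t) → ∃[ e ] (On s e × On t e)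
share⇒common s t share =
  let f , f∈ , any = find share
      g , g∈ , f~g = find any
      e , e∈ , f~e = edge⇒slot (route s) f∈
      e′ , e′∈ , g~e′ = edge⇒slot (route t) g∈
      e≡e′ = ends-injective e e′
        (SameEdge-trans (SameEdge-sym f~e) (SameEdge-trans f~g g~e′))
  in e , slots⇒On s e∈ , subst (On t) (≡-sym e≡e′) (slots⇒On t e′∈)

common⇒share : ∀ s t {e} → On s e → On t e → ShareEdge (gridPath s) (gridPath t)
common⇒share s t on on′ =
  let f , f∈ , f~e = slot⇒edge (route s) (On⇒slots s on)
      g , g∈ , g~e = slot⇒edge (route t) (On⇒slots t on′)
  in lose f∈ (lose g∈ (SameEdge-trans f~e (SameEdge-sym g~e)))

-- Inserting a vertex

digit<4 : ∀ {j} b → j < 4 → (j + b * 4) % 4 ≡ j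
digit<4 {j} b j<4 = trans ([m+kn]%n≡m%n j b 4) (m<n⇒m%n≡m j<4)

digit-unique : ∀ {i j} a b → i < 4 → j < 4 → i + a * 4 ≡ j + b * 4 → i ≡ j
digit-unique a b i<4 j<4 eq =
  trans (≡-sym (digit<4 a i<4)) (trans (cong (_% 4) eq) (digit<4 b j<4))

quotient : ∀ {j} b → j < 4 → (j + b * 4) / 4 ≡ b
quotient {j} b j<4 = trans (+-distrib-/-∣ʳ j (divides-refl b))
  (cong₂ _+_ (m<n⇒m/n≡0 j<4) (m*n/n≡m b 4))

1<4 : 1 < 4
1<4 = s≤s (s≤s z≤n)

1<3 : 1 < 3
1<3 = s≤s (s≤s z≤n)

2<4 : 2 < 4
2<4 = s≤s (s≤s (s≤s z≤n))

*4≤⁺ : ∀ {a b} j → a ≤ b → a * 4 ≤ j + b * 4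
*4≤⁺ j a≤b = ≤-trans (*-monoˡ-≤ 4 a≤b) (m≤n+m _ j)

*4<⁺ : ∀ {a b j} → j < 4 → a < b → j + a * 4 < b * 4
*4<⁺ {a} j<4 a<b = ≤-trans (+-monoˡ-≤ (a * 4) j<4) (*-monoˡ-≤ 4 a<b)

*4≤⁻ : ∀ {a b} → a * 4 ≤ b → a ≤ b / 4
*4≤⁻ {a} a≤b = subst (_≤ _) (m*n/n≡m a 4) (/-monoˡ-≤ 4 a≤b)

between-*4⁺ : ∀ {x a b j} → j < 4 → Between x a b → Between (j + x * 4) (a * 4) (b * 4)
between-*4⁺ j<4 (inj₁ (a≤x , x<b)) = inj₁ (*4≤⁺ _ a≤x , *4<⁺ j<4 x<b)
between-*4⁺ j<4 (inj₂ (b≤x , x<a)) = inj₂ (*4≤⁺ _ b≤x , *4<⁺ j<4 x<a)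

between-*4⁻ : ∀ {x a b} → Between x (a * 4) (b * 4) → Between (x / 4) a b
between-*4⁻ (inj₁ (a≤x , x<b)) = inj₁ (*4≤⁻ a≤x , m<n*o⇒m/o<n x<b)
between-*4⁻ (inj₂ (b≤x , x<a)) = inj₂ (*4≤⁻ b≤x , m<n*o⇒m/o<n x<a)

between-suc : ∀ {x a} → Between x a (suc a) → x ≡ a
between-suc (inj₁ (a≤x , x≤a)) = ≤-antisym (s≤s⁻¹ x≤a) a≤x
between-suc (inj₂ (a<x , x<a)) = contradiction a<x (<-asym x<a)

scale : Shape → Shape
scale (shape o l₁ p₀ p₁ l₂ p₂ l₁≢l₂) =
  shape o (l₁ * 4) (p₀ * 4) (p₁ * 4) (l₂ * 4) (p₂ * 4) (l₁≢l₂ ∘ *-cancelʳ-≡ _ _ 4)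

scale-On⁺ : ∀ s {o l b j} → j < 4 → On s (o , l , b) → On (scale s) (o , l * 4 , j + b * 4)
scale-On⁺ s j<4 (inj₁ (o≡ , refl , btw))        = inj₁ (o≡ , refl , between-*4⁺ j<4 btw)
scale-On⁺ s j<4 (inj₂ (inj₁ (o≡ , refl , btw))) = inj₂ (inj₁ (o≡ , refl , between-*4⁺ j<4 btw))
scale-On⁺ s j<4 (inj₂ (inj₂ (o≡ , refl , btw))) = inj₂ (inj₂ (o≡ , refl , between-*4⁺ j<4 btw))

-- A scaled path uses only lines that are multiples of 4. The lines of residue 1, 2 and 3 stay free
-- in both directions and are where private edges of the new path go.
scale-On⁻ : ∀ s {o l b} → On (scale s) (o , l , b) → ∃[ k ] (l ≡ k * 4 × On s (o , k , b / 4))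
scale-On⁻ s (inj₁ (o≡ , refl , btw))        = _ , refl , inj₁ (o≡ , refl , between-*4⁻ btw)
scale-On⁻ s (inj₂ (inj₁ (o≡ , refl , btw))) = _ , refl , inj₂ (inj₁ (o≡ , refl , between-*4⁻ btw))
scale-On⁻ s (inj₂ (inj₂ (o≡ , refl , btw))) = _ , refl , inj₂ (inj₂ (o≡ , refl , between-*4⁻ btw))

-- A crude bound, used only to find a line beyond all existing paths.
lineBound : Shape → ℕ
lineBound s = l₁ + (p₁ + l₂) where open Shape s

On-line≤ : ∀ s {o l b} → On s (o , l , b) → l ≤ lineBound s
On-line≤ s (inj₁ (_ , refl , _))        = m≤m+n _ _
On-line≤ s (inj₂ (inj₁ (_ , refl , _))) = ≤-trans (m≤m+n _ _) (m≤n+m _ (Shape.l₁ s))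
On-line≤ s (inj₂ (inj₂ (_ , refl , _))) = ≤-trans (m≤n+m _ (Shape.p₁ s)) (m≤n+m _ (Shape.l₁ s))

bounded : ∀ {k} (f : Fin k → ℕ) → ∃[ M ] (∀ i → f i ≤ M)
bounded {0}     f = 0 , λ ()
bounded {suc k} f with bounded (f ∘ F.suc)
... | M , f≤M = f F.zero ⊔ M , λ where
  F.zero    → m≤m⊔n _ _
  (F.suc i) → ≤-trans (f≤M i) (m≤n⊔m (f F.zero) M)

-- The third quarter of the scaled slot. The new path touches old paths in second quarters only, so
-- the third one keeps its old holders.
refine : Slot → Slot
refine (o , l , b) = o , l * 4 , 2 + b * 4

-- Layouts and the positions of pairs

module _ (G : Graph) where

  private
    Vertex : Set
    Vertex = Fin (n G)

  Layout : Set
  Layout = Vertex → Maybe Shape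

  Placed : Layout → Vertex → Set
  Placed L w = ∃[ s ] (L w ≡ just s)

  Occupies : Layout → Vertex → Slot → Set
  Occupies L w e = ∃[ s ] (L w ≡ just s × On s e)

  Faithful : Layout → Set
  Faithful L = ∀ u v → u ≢ v →
    (∀ e → Occupies L u e → Occupies L v e → Edge G u v) ×
    (Placed L u → Placed L v → Edge G u v → ∃[ e ] (Occupies L u e × Occupies L v e))

  Held : Layout → Vertex → Vertex → Slot → Set
  Held L u v e = Occupies L u e × Occupies L v e × (∀ w → Occupies L w e → w ≡ u ⊎ w ≡ v)

  Private : Layout → Vertex → Slot → Set
  Private L u = Held L u u

  -- The common coordinate `p` makes the two edges of `parallel` translates of each other across
  -- their direction. The vertices may coincide: one private slot makes a vertex parallel to itself,
  -- which serves when only one vertex of a bag is placed.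
  data Place (L : Layout) : Vertex → Vertex → Set where
    parallel : ∀ {u v} o {l l′} p →
               Private L u (o , l , p) → Private L v (o , l′ , p) → Place L u v
    joint    : ∀ {u v} o {l p l₁ l₂} p₁ p₂ → Held L u v (o , l , p) →
               Private L u (o , l₁ , p₁) → Private L v (not o , l₂ , p₂) → Place L u v
    flip     : ∀ {u v} → Place L v u → Place L u v

  -- What later stages need to know of an insertion. Positions survive it, since `refine` treats
  -- equal coordinates equally and preserves directions.
  record Grows (L L′ : Layout) (c : Vertex) : Set where
    field
      placed⁻     : ∀ {w} → Placed L′ w → w ≡ c ⊎ Placed L w
      placed⁺     : ∀ {w} → Placed L w → Placed L′ w
      placed-new  : Placed L′ c
      held-refine : ∀ {u v e} → Held L u v e → Held L′ u v (refine e)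

    place : ∀ {u v} → Place L u v → Place L′ u v
    place (parallel o p u! v!)     = parallel o _ (held-refine u!) (held-refine v!)
    place (joint o p₁ p₂ uv u! v!) = joint o _ _ (held-refine uv) (held-refine u!) (held-refine v!)
    place (flip pl)                = flip (place pl)

  -- A new path whose only contacts with the lines 4ℤ, which carry the scaled
  -- old paths, are the second quarters of the slots in K.
  module Extension
    (L : Layout) (faithful : Faithful L) (c : Vertex) (unplaced : L c ≡ nothing)
    (d : Shape) (K : Slot → Set)
    (sound : ∀ {o l b} → On d (o , l * 4 , b) → ∃[ b′ ] (b ≡ 1 + b′ * 4 × K (o , l , b′)))
    (complete : ∀ {o l b} → K (o , l , b) → On d (o , l * 4 , 1 + b * 4))
    (contact⇒edge : ∀ w {e} → K e → Occupies L w e → Edge G c w)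
    (edge⇒contact : ∀ w → Placed L w → Edge G c w → ∃[ e ] (K e × Occupies L w e))
    where

    L′ : Layout
    L′ w with w ≟ c
    ... | yes _ = just d
    ... | no  _ = Maybe.map scale (L w)

    L′-new : L′ c ≡ just d
    L′-new with c ≟ c
    ... | yes _ = refl
    ... | no c≢c = contradiction refl c≢c

    L′-old : ∀ {w} → w ≢ c → L′ w ≡ Maybe.map scale (L w)
    L′-old {w} w≢c with w ≟ c
    ... | yes w≡c = contradiction w≡c w≢c
    ... | no _ = refl

    placed⇒≢ : ∀ {w} → Placed L w → w ≢ c
    placed⇒≢ (_ , Lw≡) refl = case trans (≡-sym unplaced) Lw≡ of λ ()

    new⁺ : ∀ {e} → On d e → Occupies L′ c e
    new⁺ on = d , L′-new , on

    new⁻ : ∀ {e} → Occupies L′ c e → On d e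
    new⁻ (s , L′c≡ , on) with trans (≡-sym L′-new) L′c≡
    ... | refl = on

    old⁺ : ∀ {w o l b j} → j < 4 → Occupies L w (o , l , b) → Occupies L′ w (o , l * 4 , j + b * 4)
    old⁺ {w} j<4 (s , Lw≡ , on) =
      scale s , trans (L′-old (placed⇒≢ (s , Lw≡))) (cong (Maybe.map scale) Lw≡) , scale-On⁺ s j<4 on

    old⁻ : ∀ {w o l b} → w ≢ c → Occupies L′ w (o , l , b) →
           ∃[ k ] (l ≡ k * 4 × Occupies L w (o , k , b / 4))
    old⁻ {w} w≢c (s , L′w≡ , on) with L w | trans (≡-sym (L′-old w≢c)) L′w≡
    ... | just t | refl = let k , l≡ , on′ = scale-On⁻ t on in k , l≡ , t , refl , on′

    old-digit⁻ : ∀ {w o l b j} → j < 4 → w ≢ c → Occupies L′ w (o , l * 4 , j + b * 4) →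
                 Occupies L w (o , l , b)
    old-digit⁻ {l = l} {b} j<4 w≢c occ with old⁻ w≢c occ
    ... | k , l≡ , occ′ with *-cancelʳ-≡ l k 4 l≡
    ...   | refl = subst (λ x → Occupies L _ (_ , _ , x)) (quotient b j<4) occ′

    -- An old path covers all four quarters of a slot or none, so only `c` could join the holders of
    -- a quarter, and the hypothesis on `d` excludes it.
    held-digit : ∀ {u v o l b j} → j < 4 → ¬ On d (o , l * 4 , j + b * 4) →
                 Held L u v (o , l , b) → Held L′ u v (o , l * 4 , j + b * 4)
    held-digit j<4 ¬on (u∈ , v∈ , only) = old⁺ j<4 u∈ , old⁺ j<4 v∈ , λ w w∈ → only′ w w∈ (w ≟ c)
      where
      only′ : ∀ w → Occupies L′ w _ → _ → _
      only′ w w∈ (yes refl) = contradiction (new⁻ w∈) ¬on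
      only′ w w∈ (no w≢c)   = only w (old-digit⁻ j<4 w≢c w∈)

    grows : Grows L L′ c
    grows = record
      { placed⁻     = placed⁻
      ; placed⁺     = λ { {w} (s , Lw≡) → scale s ,
                          trans (L′-old (placed⇒≢ (s , Lw≡))) (cong (Maybe.map scale) Lw≡) }
      ; placed-new  = d , L′-new
      ; held-refine = λ {_} {_} {e} → held-digit 2<4 (avoid e)
      }
      where
      placed⁻ : ∀ {w} → Placed L′ w → w ≡ c ⊎ Placed L w
      placed⁻ {w} (s , L′w≡) with w ≟ c
      ... | yes w≡c = inj₁ w≡c
      ... | no w≢c with L w | L′w≡
      ...   | just t | _ = inj₂ (t , refl)
      avoid : ∀ e → ¬ On d (refine e)
      avoid (_ , l , b) on with sound {l = l} on
      -- Contacts have residue 1 and refined slots have residue 2.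
      ... | b′ , eq , _ = case digit-unique b b′ 2<4 1<4 eq of λ ()

    new-old⇒edge : ∀ {w} → w ≢ c → ∀ e → Occupies L′ c e → Occupies L′ w e → Edge G c w
    new-old⇒edge w≢c e c∈ w∈ with old⁻ w≢c w∈
    ... | k , refl , w∈′ with sound {l = k} (new⁻ c∈)
    ...   | b′ , refl , inK =
      contact⇒edge _ inK (subst (λ x → Occupies L _ (_ , k , x)) (quotient b′ 1<4) w∈′)

    edge⇒new-old : ∀ {w} → w ≢ c → Placed L′ w → Edge G c w →
                   ∃[ e ] (Occupies L′ c e × Occupies L′ w e)
    edge⇒new-old w≢c pl cw with Grows.placed⁻ grows pl
    ... | inj₁ w≡c = contradiction w≡c w≢c
    ... | inj₂ pl′ =
      let _ , inK , w∈ = edge⇒contact _ pl′ cw in _ , new⁺ (complete inK) , old⁺ 1<4 w∈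

    faithful′ : Faithful L′
    faithful′ u v u≢v = byNovelty (u ≟ c) (v ≟ c)
      where
      byNovelty : Dec (u ≡ c) → Dec (v ≡ c) →
        (∀ e → Occupies L′ u e → Occupies L′ v e → Edge G u v) ×
        (Placed L′ u → Placed L′ v → Edge G u v → ∃[ e ] (Occupies L′ u e × Occupies L′ v e))
      byNovelty (yes refl) (yes refl) = contradiction refl u≢v
      byNovelty (yes refl) (no v≢c) =
        new-old⇒edge v≢c , λ _ → edge⇒new-old v≢c
      byNovelty (no u≢c) (yes refl) =
        (λ e u∈ c∈ → trans (Graph.sym G u c) (new-old⇒edge u≢c e c∈ u∈)) ,
        λ plu _ uc → let e , c∈ , u∈ = edge⇒new-old u≢c plu (trans (Graph.sym G c u) uc) in e , u∈ , c∈
      byNovelty (no u≢c) (no v≢c) = old⇒edge , edge⇒old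
        where
        old⇒edge : ∀ e → Occupies L′ u e → Occupies L′ v e → Edge G u v
        old⇒edge e u∈ v∈ with old⁻ u≢c u∈ | old⁻ v≢c v∈
        ... | k , refl , u∈′ | k′ , eq , v∈′ with *-cancelʳ-≡ k k′ 4 eq
        ...   | refl = proj₁ (faithful u v u≢v) _ u∈′ v∈′
        old : ∀ {w} → w ≢ c → Placed L′ w → Placed L w
        old w≢c pl with Grows.placed⁻ grows pl
        ... | inj₁ w≡c = contradiction w≡c w≢c
        ... | inj₂ pl′ = pl′
        edge⇒old : Placed L′ u → Placed L′ v → Edge G u v → ∃[ e ] (Occupies L′ u e × Occupies L′ v e)
        edge⇒old plu plv uv =
          let _ , u∈ , v∈ = proj₂ (faithful u v u≢v) (old u≢c plu) (old v≢c plv) uv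
          -- Any of the four quarters would serve here, as both old paths contain them all.
          in _ , old⁺ 1<4 u∈ , old⁺ 1<4 v∈

    -- Old paths never leave the lines that are multiples of 4, so elsewhere the new path is alone.
    private-new : ∀ {o l b} → (∀ k → l ≢ k * 4) → On d (o , l , b) → Private L′ c (o , l , b)
    private-new new on = new⁺ on , new⁺ on , λ w w∈ → inj₁ (only w w∈ (w ≟ c))
      where
      only : ∀ w → Occupies L′ w _ → _ → w ≡ c
      only w w∈ (yes w≡c) = w≡c
      only w w∈ (no w≢c)  = let k , eq , _ = old⁻ w≢c w∈ in contradiction eq (new k)

    -- This supplies the shared slot of a `joint` pair: the new path takes a quarter of a slot that
    -- only `u` owned.
    held-new : ∀ {u o l b} → K (o , l , b) → Private L u (o , l , b) →
               Held L′ u c (o , l * 4 , 1 + b * 4)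
    held-new {u} inK (u∈ , _ , only) = old⁺ 1<4 u∈ , new⁺ (complete inK) , λ w w∈ → only′ w w∈ (w ≟ c)
      where
      only′ : ∀ w → Occupies L′ w _ → _ → w ≡ u ⊎ w ≡ c
      only′ w w∈ (yes w≡c) = inj₂ w≡c
      only′ w w∈ (no w≢c)  = inj₁ (reduce (only w (old-digit⁻ 1<4 w≢c w∈)))

  offLine : ∀ {j} q → j < 3 → ∀ k → suc j + q * 4 ≢ k * 4
  offLine q j<3 k eq = case digit-unique q k (s≤s j<3) (s≤s z≤n) eq of λ ()

  -- Stopping just short of or just beyond the slot 2 + 4p, according to the
  -- side from which it is approached.
  target : ∀ i → i ≤ 2 → ∀ x p →
    ∃[ j ] (j < 2 × Between (2 + p * 4) (i + x * 4) (2 + j + p * 4))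
  target i i≤2 x p with x ≤? p
  ... | yes x≤p = 1 , ≤-refl , inj₁ (+-mono-≤ i≤2 (*-monoˡ-≤ 4 x≤p) , ≤-refl)
  ... | no  x≰p = 0 , s≤s z≤n , inj₂ (≤-refl , ≤-trans (*4<⁺ 2<4 (≰⇒> x≰p)) (m≤n+m _ i))

  -- Choosing the new path

  module _ (L : Layout) (faithful : Faithful L) (c : Vertex) (unplaced : L c ≡ nothing) where

    -- The coordinates are those given by `refine`, so that `c` becomes parallel to any vertex with
    -- a private slot at `p` along `o`, or at `q` across it.
    Attached : Bool → ℕ → ℕ → Set
    Attached o p q = ∃[ L′ ] (Faithful L′ × Grows L L′ c ×
      (∃[ l ] Private L′ c (o , l , 2 + p * 4)) × (∃[ l ] Private L′ c (not o , l , 2 + q * 4)))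

    -- The first leg is just the second quarter of the given slot. The crossing leg lies on a line
    -- of residue 2 and passes `q`; the last leg lies on a line of residue 2 or 3 and passes `p`.
    -- Both are therefore private.
    attach : ∀ o x y →
             (∀ w → Occupies L w (o , x , y) → Edge G c w) →
             (∀ w → Placed L w → Edge G c w → Occupies L w (o , x , y)) →
             ∀ p q → Attached o p q
    -- The offsets are the residues of the starting points: the crossing leg leaves the line
    -- `x * 4`, and the last leg starts at `2 + y * 4`.
    attach o x y occ⇒edge edge⇒occ p q with target 0 z≤n x q | target 2 ≤-refl y p
    ... | j , j<2 , across | _ , _ , along =
      E.L′ , E.faithful′ , E.grows ,
      (_ , E.private-new (offLine q (s≤s j<2)) (inj₂ (inj₂ (refl , refl , along)))) ,
      (_ , E.private-new (offLine y 1<3) (inj₂ (inj₁ (refl , refl , across))))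
      where
      d : Shape
      d = shape o (x * 4) (1 + y * 4) (2 + y * 4) (2 + j + q * 4) _
            (offLine q (s≤s j<2) x ∘ ≡-sym)
      sound : ∀ {o′ l b} → On d (o′ , l * 4 , b) →
              ∃[ b′ ] (b ≡ 1 + b′ * 4 × (o′ , l , b′) ≡ (o , x , y))
      sound {l = l} (inj₁ (refl , l≡ , btw)) with *-cancelʳ-≡ l x 4 l≡
      ... | refl = y , between-suc btw , refl
      sound {l = l} (inj₂ (inj₁ (_ , l≡ , _))) = contradiction (≡-sym l≡) (offLine y 1<3 l)
      sound {l = l} (inj₂ (inj₂ (_ , l≡ , _))) = contradiction (≡-sym l≡) (offLine q (s≤s j<2) l)
      complete : ∀ {o′ l b} → (o′ , l , b) ≡ (o , x , y) → On d (o′ , l * 4 , 1 + b * 4)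
      complete refl = inj₁ (refl , refl , inj₁ (≤-refl , ≤-refl))
      contact⇒edge : ∀ w {e} → e ≡ (o , x , y) → Occupies L w e → Edge G c w
      contact⇒edge w refl = occ⇒edge w
      module E = Extension L faithful c unplaced d (_≡ (o , x , y)) sound complete contact⇒edge
        (λ w pl cw → _ , refl , edge⇒occ w pl cw)

    attach-held : ∀ {u v} o {l b} → Held L u v (o , l , b) → Edge G c u → Edge G c v →
                  (∀ w → Placed L w → Edge G c w → w ≡ u ⊎ w ≡ v) → ∀ p q → Attached o p q
    attach-held o (u∈ , v∈ , only) cu cv near = attach o _ _
      (λ w w∈ → case only w w∈ of λ { (inj₁ refl) → cu ; (inj₂ refl) → cv })
      (λ w pl cw → case near w pl cw of λ { (inj₁ refl) → u∈ ; (inj₂ refl) → v∈ })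

    attach-isolated : (∀ w → Placed L w → ¬ Edge G c w) → ∀ o p q → Attached o p q
    -- The line `suc M` is used by no path, so the starting slot there is empty; its coordinate 0 is
    -- arbitrary.
    attach-isolated isolated o = attach o (suc M) 0
      (λ w w∈ → contradiction (line≤ w w∈) (n≮n M))
      (λ w pl cw → contradiction cw (isolated w pl))
      where
      -- The default 0 is harmless, since an unplaced vertex occupies no slot.
      bound = bounded (λ w → maybe′ lineBound 0 (L w))
      M = proj₁ bound
      line≤ : ∀ w {o l b} → Occupies L w (o , l , b) → l ≤ M
      line≤ w (s , Lw≡ , on) with L w | Lw≡ | proj₂ bound w
      ... | just _ | refl | ≤M = ≤-trans (On-line≤ s on) ≤M

    Inserted : Vertex → Vertex → Set
    Inserted a b = ∃[ L′ ] (Faithful L′ × Grows L L′ c ×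
      Place L′ c c × Place L′ a c × Place L′ b c)

    Reaches : Bool → ℕ → ℕ → Vertex → Set
    Reaches o p q a = (∃[ l ] Private L a (o , l , p)) ⊎ (∃[ l ] Private L a (not o , l , q))

    attached⇒inserted : ∀ {o} p q {a b} → Attached o p q → Reaches o p q a → Reaches o p q b →
                        Inserted a b
    attached⇒inserted {o} p q (L′ , faith , grows , (_ , c!) , (_ , c!′)) ra rb =
      L′ , faith , grows , parallel o _ c! c! , beside ra , beside rb
      where
      open Grows grows
      beside : ∀ {a} → Reaches o p q a → Place L′ a c
      beside (inj₁ (_ , a!)) = parallel o _ (held-refine a!) c!
      beside (inj₂ (_ , a!)) = parallel (not o) _ (held-refine a!) c!′

    -- As the private slots have the same coordinate, one crossing leg on a line of residue 2 meets
    -- both. Each old vertex then shares a second quarter with `c` and keeps its third quarter along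
    -- `o`, while `c` owns the crossing leg: this is `joint`.
    bridge : ∀ {a b} o {l l′} p → Private L a (o , l , p) → Private L b (o , l′ , p) → a ≢ b →
             Edge G c a → Edge G c b → (∀ w → Placed L w → Edge G c w → w ≡ a ⊎ w ≡ b) →
             Inserted a b
    bridge {a} {b} o {l} {l′} p a! b! a≢b ca cb near =
      E.L′ , E.faithful′ , E.grows , parallel (not o) _ c! c! ,
      joint o _ _ (E.held-new (inj₁ refl) a!) (held-refine a!) c! ,
      joint o _ _ (E.held-new (inj₂ refl) b!) (held-refine b!) c!
      where
      l≢l′ : l ≢ l′
      -- On one line the two slots would be the same, and a private slot has a single owner.
      l≢l′ refl = a≢b (≡-sym (reduce (proj₂ (proj₂ a!) b (proj₁ b!))))
      d : Shape
      -- Both outer legs are second quarters; the last one is run backwards.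
      d = shape o (l * 4) (1 + p * 4) (2 + p * 4) (l′ * 4) (1 + p * 4) (l≢l′ ∘ *-cancelʳ-≡ l l′ 4)
      K : Slot → Set
      K e = e ≡ (o , l , p) ⊎ e ≡ (o , l′ , p)
      sound : ∀ {o′ k b} → On d (o′ , k * 4 , b) → ∃[ b′ ] (b ≡ 1 + b′ * 4 × K (o′ , k , b′))
      sound {k = k} (inj₁ (refl , k≡ , btw)) with *-cancelʳ-≡ k l 4 k≡
      ... | refl = p , between-suc btw , inj₁ refl
      sound {k = k} (inj₂ (inj₁ (_ , k≡ , _))) = contradiction (≡-sym k≡) (offLine p 1<3 k)
      sound {k = k} (inj₂ (inj₂ (refl , k≡ , btw))) with *-cancelʳ-≡ k l′ 4 k≡
      ... | refl = p , between-suc (swap btw) , inj₂ refl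
      complete : ∀ {o′ k b} → K (o′ , k , b) → On d (o′ , k * 4 , 1 + b * 4)
      complete (inj₁ refl) = inj₁ (refl , refl , inj₁ (≤-refl , ≤-refl))
      complete (inj₂ refl) = inj₂ (inj₂ (refl , refl , inj₂ (≤-refl , ≤-refl)))
      contact⇒edge : ∀ w {e} → K e → Occupies L w e → Edge G c w
      contact⇒edge w (inj₁ refl) w∈ = subst (Edge G c) (≡-sym (reduce (proj₂ (proj₂ a!) w w∈))) ca
      contact⇒edge w (inj₂ refl) w∈ = subst (Edge G c) (≡-sym (reduce (proj₂ (proj₂ b!) w w∈))) cb
      edge⇒contact : ∀ w → Placed L w → Edge G c w → ∃[ e ] (K e × Occupies L w e)
      edge⇒contact w pl cw with near w pl cw
      ... | inj₁ refl = _ , inj₁ refl , proj₁ a!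
      ... | inj₂ refl = _ , inj₂ refl , proj₁ b!
      module E = Extension L faithful c unplaced d K sound complete contact⇒edge edge⇒contact
      open Grows E.grows
      c! : Private E.L′ c (not o , 2 + p * 4 , _)
      -- Any slot of the crossing leg will do, because `joint` puts no condition on coordinates.
      c! = E.private-new (offLine p 1<3)
             (inj₂ (inj₁ (refl , refl , proj₂ (between-nonempty (l≢l′ ∘ *-cancelʳ-≡ l l′ 4)))))

    insert : ∀ {a b} → Place L a b → (∀ w → Placed L w → Edge G c w → w ≡ a ⊎ w ≡ b) → Inserted a b
    insert {a} {b} place near = byAdjacency place (adj G c a) (adj G c b) refl refl
      where
      only-a : adj G c b ≡ false → ∀ w → Placed L w → Edge G c w → w ≡ a ⊎ w ≡ a
      only-a cb w pw cw with near w pw cw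
      ... | inj₁ w≡a = inj₁ w≡a
      ... | inj₂ refl = case trans (≡-sym cb) cw of λ ()
      only-b : adj G c a ≡ false → ∀ w → Placed L w → Edge G c w → w ≡ b ⊎ w ≡ b
      only-b ca w pw cw with near w pw cw
      ... | inj₁ refl = case trans (≡-sym ca) cw of λ ()
      ... | inj₂ w≡b = inj₁ w≡b
      isolated : adj G c a ≡ false → adj G c b ≡ false → ∀ w → Placed L w → ¬ Edge G c w
      isolated ca cb w pw cw with only-a cb w pw cw
      ... | inj₁ refl = case trans (≡-sym ca) cw of λ ()
      ... | inj₂ refl = case trans (≡-sym ca) cw of λ ()

      byAdjacency : Place L a b → ∀ x y → adj G c a ≡ x → adj G c b ≡ y → Inserted a b
      byAdjacency (flip pl) _ _ _ _ =
        let L′ , faith , grows , cc , bc , ac = insert pl (λ w pw cw → swap (near w pw cw))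
        in L′ , faith , grows , cc , ac , bc
      byAdjacency (parallel o p a! b!) true true ca cb with a ≟ b
      ... | no a≢b   = bridge o p a! b! a≢b ca cb near
      -- Both vertices are reached along `o` at `p`, so the coordinate 0 across is arbitrary, here
      -- and in the next three cases.
      ... | yes refl = attached⇒inserted p 0 (attach-held o a! ca ca near p 0) (inj₁ (_ , a!)) (inj₁ (_ , b!))
      byAdjacency (parallel o p a! b!) true false ca cb =
        attached⇒inserted p 0 (attach-held o a! ca ca (only-a cb) p 0) (inj₁ (_ , a!)) (inj₁ (_ , b!))
      byAdjacency (parallel o p a! b!) false true ca cb =
        attached⇒inserted p 0 (attach-held o b! cb cb (only-b ca) p 0) (inj₁ (_ , a!)) (inj₁ (_ , b!))
      byAdjacency (parallel o p a! b!) false false ca cb =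
        attached⇒inserted p 0 (attach-isolated (isolated ca cb) o p 0) (inj₁ (_ , a!)) (inj₁ (_ , b!))
      byAdjacency (joint o p₁ p₂ ab a! b!) true true ca cb =
        attached⇒inserted p₁ p₂ (attach-held o ab ca cb near p₁ p₂) (inj₁ (_ , a!)) (inj₂ (_ , b!))
      byAdjacency (joint o p₁ p₂ ab a! b!) true false ca cb =
        attached⇒inserted p₁ p₂ (attach-held o a! ca ca (only-a cb) p₁ p₂) (inj₁ (_ , a!)) (inj₂ (_ , b!))
      byAdjacency (joint o p₁ p₂ ab a! b!) false true ca cb =
        -- The path must start on the private slot of `b`, which runs across, so the two directions
        -- and coordinates trade places, and `a` is reached along `not (not o)`.
        attached⇒inserted p₂ p₁ (attach-held (not o) b! cb cb (only-b ca) p₂ p₁)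
          (inj₂ (_ , subst (λ o → Private L a (o , _ , p₁)) (≡-sym (not-involutive o)) a!))
          (inj₁ (_ , b!))
      byAdjacency (joint o p₁ p₂ ab a! b!) false false ca cb =
        attached⇒inserted p₁ p₂ (attach-isolated (isolated ca cb) o p₁ p₂) (inj₁ (_ , a!)) (inj₂ (_ , b!))

-- Sweeping the tree decomposition

module _ {T : Tree} where

  data Below (s : Node T) : Node T → Set where
    self  : Below s s
    child : ∀ {i} → Below s (parent T i) → Below s (F.suc i)

  below⇒≤ : ∀ {s t} → Below s t → toℕ s ≤ toℕ t
  below⇒≤ self              = ≤-refl
  below⇒≤ (child {i} below) = ≤-trans (below⇒≤ below) (m≤n⇒m≤1+n (parent< T i))

  -- The only tree edge leaving the subtree of `suc i` leads to its parent, so a walk out of the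
  -- subtree visits the parent.
  walk-exits : ∀ {P : Node T → Set} {i s t} → WalkIn T P s t →
               Below (F.suc i) s → ¬ Below (F.suc i) t → P (parent T i)
  walk-exits here below ¬below = contradiction below ¬below
  walk-exits (step (inj₁ (_ , refl , refl)) Px w) self          ¬below = Px
  walk-exits (step (inj₁ (_ , refl , refl)) Px w) (child below) ¬below = walk-exits w below ¬below
  walk-exits (step (inj₂ (_ , refl , refl)) Px w) below         ¬below =
    walk-exits w (child below) ¬below

-- Short bags are padded by repetition. This costs nothing later, as `add` leaves the layout alone
-- when its vertex is already placed.
three : ∀ {A : Set} (xs : List A) → length xs ≤ 3 →
        xs ≡ [] ⊎ ∃[ x ] ∃[ y ] ∃[ z ] (x ∈ xs × y ∈ xs × z ∈ xs ×
          (∀ {w} → w ∈ xs → w ≡ x ⊎ w ≡ y ⊎ w ≡ z))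
three []              _ = inj₁ refl
three (x ∷ [])        _ = inj₂ (x , x , x , here refl , here refl , here refl , λ where
  (here w≡x) → inj₁ w≡x)
three (x ∷ y ∷ [])    _ = inj₂ (x , y , y , here refl , there (here refl) , there (here refl) , λ where
  (here w≡x)         → inj₁ w≡x
  (there (here w≡y)) → inj₂ (inj₁ w≡y))
three (x ∷ y ∷ z ∷ []) _ =
  inj₂ (x , y , z , here refl , there (here refl) , there (there (here refl)) , λ where
    (here w≡x)                 → inj₁ w≡x
    (there (here w≡y))         → inj₂ (inj₁ w≡y)
    (there (there (here w≡z))) → inj₂ (inj₂ w≡z))
three (_ ∷ _ ∷ _ ∷ _ ∷ _) (s≤s (s≤s (s≤s ())))

-- Filling the bags in order

module _ {G : Graph} where

  placed? : ∀ (L : Layout G) v → Dec (Placed G L v)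
  placed? L v with L v
  ... | just s  = yes (s , refl)
  ... | nothing = no λ ()

  unplaced : ∀ (L : Layout G) v → ¬ Placed G L v → L v ≡ nothing
  unplaced L v ¬pl with L v
  ... | just s  = contradiction (s , refl) ¬pl
  ... | nothing = refl

  module _ (D : TreeDecomposition G 2) where
    open TreeDecomposition D

    Seen : ℕ → Fin (n G) → Set
    Seen k v = ∃[ t ] (toℕ t < k × v ∈ bag t)

    -- Indices grow towards the leaves, so `r` is outside the subtree of `suc i`, and the walk
    -- between the two bags of `v` passes the parent.
    bag-parent : ∀ {v i r} → v ∈ bag (F.suc i) → v ∈ bag r → toℕ r ≤ toℕ i → v ∈ bag (parent tree i)
    bag-parent v∈ v∈r r≤i = walk-exits (connected _ _ _ v∈ v∈r) self
      (λ below → <⇒≱ (below⇒≤ below) r≤i)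

    -- The Helly property of subtrees, for the nodes of `u`, those of `v` and those of index below
    -- `k`. Climbing from a common bag to its parent keeps both vertices until the index drops below
    -- `k`; `fuel` bounds the climb.
    seen-together : ∀ {k u v} → Seen k u → Seen k v →
      ∀ fuel s → toℕ s ≤ fuel → u ∈ bag s → v ∈ bag s →
      ∃[ t ] (toℕ t < k × u ∈ bag t × v ∈ bag t)
    seen-together (_ , r<k , _) _ _ F.zero _ u∈ v∈ = F.zero , ≤-trans (s≤s z≤n) r<k , u∈ , v∈
    seen-together {k} su@(_ , r<k , u∈r) sv@(_ , r′<k , v∈r′) (suc fuel) (F.suc i) (s≤s i≤fuel) u∈ v∈
      with toℕ (F.suc i) <? k
    ... | yes s<k = F.suc i , s<k , u∈ , v∈
    ... | no  s≮k = seen-together su sv fuel (parent tree i) (≤-trans (parent< tree i) i≤fuel)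
      (bag-parent u∈ u∈r (s≤s⁻¹ (≤-trans r<k k≤))) (bag-parent v∈ v∈r′ (s≤s⁻¹ (≤-trans r′<k k≤)))
      where
      k≤ : k ≤ suc (toℕ i)
      k≤ = ≮⇒≥ s≮k

    <suc-split : ∀ {t t′ : Node tree} → toℕ t′ < suc (toℕ t) → toℕ t′ < toℕ t ⊎ t′ ≡ t
    <suc-split t′≤t with m≤n⇒m<n∨m≡n (s≤s⁻¹ t′≤t)
    ... | inj₁ t′<t = inj₁ t′<t
    ... | inj₂ t′≡t = inj₂ (toℕ-injective t′≡t)

    record State (k : ℕ) : Set where
      field
        layout      : Layout G
        faithful    : Faithful G layout
        placed⇒seen : ∀ {v} → Placed G layout v → Seen k v
        seen⇒placed : ∀ {v} → Seen k v → Placed G layout v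
        places      : ∀ {t u v} → toℕ t < k → u ∈ bag t → v ∈ bag t → Place G layout u v

    -- The vertices of bag `t` enter one at a time, so positions within this bag are demanded only
    -- between those already placed.
    record Partial (t : Node tree) (L : Layout G) : Set where
      field
        faithful    : Faithful G L
        placed⇒seen : ∀ {v} → Placed G L v → Seen (toℕ t) v ⊎ v ∈ bag t
        seen⇒placed : ∀ {v} → Seen (toℕ t) v → Placed G L v
        places      : ∀ {t′ u v} → toℕ t′ < toℕ t → u ∈ bag t′ → v ∈ bag t′ → Place G L u v
        bag-places  : ∀ {u v} → u ∈ bag t → v ∈ bag t → Placed G L u → Placed G L v → Place G L u v

    module _ (t : Node tree) where

      record Added (L : Layout G) (c : Fin (n G)) : Set where
        field
          layout   : Layout G
          partial  : Partial t layout
          placed   : Placed G layout c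
          placed⁺  : ∀ {w} → Placed G L w → Placed G layout w

      add : ∀ {L c a b} → Partial t L → c ∈ bag t → a ∈ bag t → b ∈ bag t →
            (∀ {w} → w ∈ bag t → w ≡ c ⊎ w ≡ a ⊎ w ≡ b) → Added L c
      add {L} {c} {a} {b} P c∈ a∈ b∈ covers with placed? L c
      ... | yes pl = record { layout = L ; partial = P ; placed = pl ; placed⁺ = λ pw → pw }
      ... | no ¬pl = record
        { layout  = L′
        ; partial = record
          { faithful    = proj₁ (proj₂ inserted)
          ; placed⇒seen = λ pw → case placed⁻ pw of λ where
              (inj₁ refl) → inj₂ c∈
              (inj₂ pw′)  → P.placed⇒seen pw′
          ; seen⇒placed = placed⁺ ∘ P.seen⇒placed
          ; places      = λ t′< u∈ v∈ → place (P.places t′< u∈ v∈)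
          ; bag-places  = λ u∈ v∈ pu pv → bag-places′ u∈ v∈ (placed⁻ pu) (placed⁻ pv)
          }
        ; placed  = placed-new
        ; placed⁺ = placed⁺
        }
        where
        module P = Partial P

        -- If `w` was seen before, `seen-together` moves a bag containing `c` and `w` to an index of
        -- at most `t`. A smaller index than `t` would mean that `c` is already placed.
        near-bag : ∀ w → Placed G L w → Edge G c w → w ∈ bag t
        near-bag w pw cw with P.placed⇒seen pw
        ... | inj₂ w∈ = w∈
        ... | inj₁ (r , r<t , w∈r) with ecover c w cw
        ...   | s , c∈s , w∈s with seen-together (t , ≤-refl , c∈) (r , m≤n⇒m≤1+n r<t , w∈r)
                                     (toℕ s) s ≤-refl c∈s w∈s
        ...     | t′ , t′≤t , c∈t′ , w∈t′ with <suc-split t′≤t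
        ...       | inj₁ t′<t = contradiction (P.seen⇒placed (t′ , t′<t , c∈t′)) ¬pl
        ...       | inj₂ refl = w∈t′

        covers′ : ∀ {w} → w ∈ bag t → Placed G L w → w ≡ a ⊎ w ≡ b
        covers′ w∈ pw with covers w∈
        ... | inj₁ refl = contradiction pw ¬pl
        ... | inj₂ w≡   = w≡

        InsertedInBag : Set
        InsertedInBag = ∃[ L′ ] (Faithful G L′ × Grows G L L′ c × Place G L′ c c ×
          (∀ {w} → w ∈ bag t → Placed G L w → Place G L′ w c))

        insert-next-to : ∀ {u v} → u ∈ bag t → v ∈ bag t → Placed G L u → Placed G L v →
          (∀ {w} → w ∈ bag t → Placed G L w → w ≡ u ⊎ w ≡ v) → InsertedInBag
        insert-next-to u∈ v∈ pu pv only
          with insert G L P.faithful c (unplaced L c ¬pl) (P.bag-places u∈ v∈ pu pv)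
                 (λ w pw cw → only (near-bag w pw cw) pw)
        ... | L′ , faith , grows , cc , uc , vc = L′ , faith , grows , cc , λ w∈ pw →
          case only w∈ pw of λ { (inj₁ refl) → uc ; (inj₂ refl) → vc }

        inserted : InsertedInBag
        inserted with placed? L a | placed? L b
        ... | yes pa | yes pb = insert-next-to a∈ b∈ pa pb covers′
        -- The single placed vertex takes both roles, using its position relative to itself.
        ... | yes pa | no ¬pb = insert-next-to a∈ a∈ pa pa λ w∈ pw → case covers′ w∈ pw of λ where
          (inj₁ w≡a)  → inj₁ w≡a
          (inj₂ refl) → contradiction pw ¬pb
        ... | no ¬pa | yes pb = insert-next-to b∈ b∈ pb pb λ w∈ pw → case covers′ w∈ pw of λ where
          (inj₁ refl) → contradiction pw ¬pa
          (inj₂ w≡b)  → inj₁ w≡b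
        ... | no ¬pa | no ¬pb =
          let L′ , faith , grows , (_ , c!) , _ =
                attach-isolated G L P.faithful c (unplaced L c ¬pl)
                  (λ w pw cw → none (near-bag w pw cw) pw) true 0 0
          in L′ , faith , grows , parallel true _ c! c! , λ w∈ pw → contradiction pw (none w∈)
          where
          none : ∀ {w} → w ∈ bag t → ¬ Placed G L w
          none w∈ pw with covers′ w∈ pw
          ... | inj₁ refl = ¬pa pw
          ... | inj₂ refl = ¬pb pw

        L′ = proj₁ inserted
        open Grows (proj₁ (proj₂ (proj₂ inserted)))

        bag-places′ : ∀ {u v} → u ∈ bag t → v ∈ bag t → u ≡ c ⊎ Placed G L u → v ≡ c ⊎ Placed G L v →
                      Place G L′ u v
        bag-places′ u∈ v∈ (inj₁ refl) (inj₁ refl) = proj₁ (proj₂ (proj₂ (proj₂ inserted)))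
        bag-places′ u∈ v∈ (inj₁ refl) (inj₂ pv)   = flip (proj₂ (proj₂ (proj₂ (proj₂ inserted))) v∈ pv)
        bag-places′ u∈ v∈ (inj₂ pu)   (inj₁ refl) = proj₂ (proj₂ (proj₂ (proj₂ inserted))) u∈ pu
        bag-places′ u∈ v∈ (inj₂ pu)   (inj₂ pv)   = place (P.bag-places u∈ v∈ pu pv)

      -- Two vertices of bag `t` that occurred earlier are both in the parent bag, and their
      -- position is known from there.
      begin-bag : (S : State (toℕ t)) → Partial t (State.layout S)
      begin-bag S = record
        { faithful    = S.faithful
        ; placed⇒seen = inj₁ ∘ S.placed⇒seen
        ; seen⇒placed = S.seen⇒placed
        ; places      = S.places
        ; bag-places  = λ u∈ v∈ pu pv → in-parent t S.places u∈ v∈ (S.placed⇒seen pu) (S.placed⇒seen pv)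
        }
        where
        module S = State S
        in-parent : ∀ t → (∀ {t′ u v} → toℕ t′ < toℕ t → u ∈ bag t′ → v ∈ bag t′ → Place G S.layout u v) →
                    ∀ {u v} → u ∈ bag t → v ∈ bag t → Seen (toℕ t) u → Seen (toℕ t) v → Place G S.layout u v
        in-parent F.zero    _      _  _  (_ , () , _) _
        in-parent (F.suc i) places u∈ v∈ (_ , r≤i , u∈r) (_ , r′≤i , v∈r′) =
          places (s≤s (parent< tree i))
            (bag-parent u∈ u∈r (s≤s⁻¹ r≤i)) (bag-parent v∈ v∈r′ (s≤s⁻¹ r′≤i))

      end-bag : ∀ {L} → Partial t L → (∀ {w} → w ∈ bag t → Placed G L w) → State (suc (toℕ t))
      end-bag {L} P all-placed = record
        { layout      = L
        ; faithful    = P.faithful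
        ; placed⇒seen = λ pv → case P.placed⇒seen pv of λ where
            (inj₁ (r , r<t , v∈)) → r , m≤n⇒m≤1+n r<t , v∈
            (inj₂ v∈)             → t , ≤-refl , v∈
        ; seen⇒placed = λ (r , r≤t , v∈) → case <suc-split r≤t of λ where
            (inj₁ r<t)  → P.seen⇒placed (r , r<t , v∈)
            (inj₂ refl) → all-placed v∈
        ; places      = λ t′≤t u∈ v∈ → case <suc-split t′≤t of λ where
            (inj₁ t′<t) → P.places t′<t u∈ v∈
            (inj₂ refl) → P.bag-places u∈ v∈ (all-placed u∈) (all-placed v∈)
        }
        where module P = Partial P

      add-bag : State (toℕ t) → State (suc (toℕ t))
      add-bag S with three (bag t) (bagSize t)
      ... | inj₁ empty = end-bag (begin-bag S) (λ w∈ → case subst (_ ∈_) empty w∈ of λ ())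
      ... | inj₂ (x , y , z , x∈ , y∈ , z∈ , covers) = end-bag Z.partial λ w∈ → case covers w∈ of λ where
          (inj₁ refl)        → Z.placed⁺ (Y.placed⁺ X.placed)
          (inj₂ (inj₁ refl)) → Z.placed⁺ Y.placed
          (inj₂ (inj₂ refl)) → Z.placed
        where
        addedX : Added (State.layout S) x
        addedX = add (begin-bag S) x∈ y∈ z∈ covers
        module X = Added addedX
        addedY : Added X.layout y
        addedY = add X.partial y∈ x∈ z∈ (λ w∈ → case covers w∈ of λ where
          (inj₁ w≡x)        → inj₂ (inj₁ w≡x)
          (inj₂ (inj₁ w≡y)) → inj₁ w≡y
          (inj₂ (inj₂ w≡z)) → inj₂ (inj₂ w≡z))
        module Y = Added addedY
        addedZ : Added Y.layout z
        addedZ = add Y.partial z∈ x∈ y∈ (λ w∈ → case covers w∈ of λ where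
          (inj₁ w≡x)        → inj₂ (inj₁ w≡x)
          (inj₂ (inj₁ w≡y)) → inj₂ (inj₂ w≡y)
          (inj₂ (inj₂ w≡z)) → inj₁ w≡z)
        module Z = Added addedZ

    state : ∀ k → k ≤ suc (m tree) → State k
    state zero    _   = record
      { layout      = λ _ → nothing
      ; faithful    = λ _ _ _ → (λ { _ (_ , () , _) _ }) , (λ { (_ , ()) _ _ })
      ; placed⇒seen = λ { (_ , ()) }
      ; seen⇒placed = λ { (_ , () , _) }
      ; places      = λ ()
      }
    state (suc k) k<m = subst (State ∘ suc) (toℕ-fromℕ< k<m)
      (add-bag (fromℕ< k<m) (subst State (≡-sym (toℕ-fromℕ< k<m)) (state k (<⇒≤ k<m))))

theorem1 : (G : Graph) → TreewidthAtMost 2 G → IsKBend 2 G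
theorem1 G D = record
  { path     = path
  ; fewBends = λ u → gridPath-bends (proj₁ (placed u))
  ; faithful = λ u v u≢v →
      (λ share → let e , u∈ , v∈ = share⇒common (proj₁ (placed u)) (proj₁ (placed v)) share
                 in proj₁ (S.faithful u v u≢v) e (_ , proj₂ (placed u) , u∈) (_ , proj₂ (placed v) , v∈)) ,
      (λ uv → let e , u∈ , v∈ = proj₂ (S.faithful u v u≢v) (placed u) (placed v) uv
              in common⇒share (proj₁ (placed u)) (proj₁ (placed v)) (on u u∈) (on v v∈))
  }
  where
  open TreeDecomposition D
  module S = State (state D _ ≤-refl)
  placed : ∀ v → Placed G S.layout v
  placed v = let t , v∈ = vcover v in S.seen⇒placed (t , toℕ<n t , v∈)
  path : Fin (n G) → GridPath
  path v = gridPath (proj₁ (placed v))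
  on : ∀ v {e} → Occupies G S.layout v e → On (proj₁ (placed v)) e
  on v (s , Lv≡ , on-s) with just-injective (trans (≡-sym Lv≡) (proj₂ (placed v)))
  ... | refl = on-s
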